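{- Let $0<d_1\mid\cdots\mid d_r$ be the invariant factors of $B$, where $r=\operatorname{rank}(B)$. For any positive integers $p,q$, if $\gcd(p,d_i)\gcd(q,d_i)\mid d_i$ for all $1\le i\le r$ and $[\mathbf b]_{pq}\in\mathrm{Col}_{pq}(B)$, then $$\#M\big(\mathcal{A}_q^{(B,\mathbf b)}\big)\le \#M\big(\mathcal{A}_{pq}^{(B,\mathbf b)}\big).$$ Moreover, when $l=0$, for all positive integers $p,q$ we have $$\#M(\mathcal{A}_q)\le \#M(\mathcal{A}_{pq}).$$
   Context: Let $A$ be an $m\times n$ integer matrix with rows $\boldsymbol\alpha_1^T,\dots,\boldsymbol\alpha_m^T$, $B$ an $l\times n$ integer matrix ($l=0$ is allowed: no equations), $\mathbf a=(a_1,\dots,a_m)^T\in\mathbb{Z}^m$, and $\mathbf b\in\mathbb{Z}^l$. For a positive integer $q$, $\mathbb{Z}_q=\mathbb{Z}/q\mathbb{Z}$ and $[\cdot]_q$ is the entrywise reduction modulo $q$; $\mathrm{Col}_q(B)\subseteq\mathbb{Z}_q^l$ is the $\mathbb{Z}_q$-submodule generated by the columns of $[B]_q$. Put $V_q(B,\mathbf b)=\{\mathbf x\in\mathbb{Z}_q^n : [B]_q\mathbf x=[\mathbf b]_q\}$, $H_{i,q}^{(B,\mathbf b)}=\{\mathbf x\in V_q(B,\mathbf b): [\boldsymbol\alpha_i^T]_q\mathbf x=[a_i]_q\}$, and $M\big(\mathcal{A}_q^{(B,\mathbf b)}\big)=V_q(B,\mathbf b)\setminus\bigcup_{i=1}^m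 H_{i,q}^{(B,\mathbf b)}$. When $l=0$, $V_q(B,\mathbf b)=\mathbb{Z}_q^n$ and $M\big(\mathcal{A}_q^{(B,\mathbf b)}\big)$ is written $M(\mathcal{A}_q)$. The invariant factors of an integer matrix are the nonzero diagonal entries (taken positive, each dividing the next) of its Smith normal form. -}

module Defs where

open import Algebra.Bundles.Raw using (RawSemiring)
open import Data.Fin.Base using (Fin; toℕ; fromℕ<; finToFun; inject≤)
import Data.Fin.Properties as Fin
open import Data.Integer.Base as ℤ using (ℤ; +_; 0ℤ; _%ℕ_)
open import Data.Integer.DivMod using (n%ℕd<d)
open import Data.Nat.Base using (ℕ; suc; NonZero; _≤_; _<_; _^_)
open import Data.Nat.Divisibility using (_∣_)
open import Data.Product.Base using (∃; _×_)
open import Data.Vec.Base as Vec using (Vec)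
open import Data.Vec.Functional using (Vector)
open import Level using (0ℓ)
open import Relation.Binary.PropositionalEquality using (_≡_; _≢_)
open import Relation.Nullary using (yes; no; ¬?)
open import Relation.Nullary.Decidable using (_×-dec_)
open import Relation.Unary using (Pred; Decidable; _∩_; _∖_; ⋃)

Matrix : Set → ℕ → ℕ → Set
Matrix R m n = Vector (Vector R n) m

column : ∀ {R m n} → Matrix R m n → Fin n → Vector R m
column M j i = M i j

module LinearAlgebra (R : RawSemiring 0ℓ 0ℓ) where

  open RawSemiring R using (Carrier; _+_; _*_; 0#; 1#; +-rawMonoid)
  open import Algebra.Definitions.RawMonoid +-rawMonoid public using (sum)

  infixl 7 _·_ _∙ᵥ_ _∙ₘ_

  _·_ : ∀ {n} → Vector Carrier n → Vector Carrier n → Carrier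
  u · v = sum (λ j → u j * v j)

  _∙ᵥ_ : ∀ {m n} → Matrix Carrier m n → Vector Carrier n → Vector Carrier m
  (M ∙ᵥ x) i = M i · x

  _∙ₘ_ : ∀ {k m n} → Matrix Carrier k m → Matrix Carrier m n → Matrix Carrier k n
  (M ∙ₘ N) i j = M i · column N j

  1ₘ : ∀ {n} → Matrix Carrier n n
  1ₘ i j with i Fin.≟ j
  ... | yes _ = 1#
  ... | no  _ = 0#

  -- The submodule generated by finitely many vectors: the set of all their
  -- linear combinations.
  Span : ∀ {k l} → Vector (Vector Carrier l) k → Pred (Vector Carrier l) 0ℓ
  Span {k} v w = ∃ λ (c : Vector Carrier k) → ∀ i → w i ≡ sum (λ j → c j * v j i)

module ℤLin = LinearAlgebra ℤ.+-*-rawSemiring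

module _ where
  open ℤLin

  record Invertible {n} (U : Matrix ℤ n n) : Set where
    field
      inverse  : Matrix ℤ n n
      inverseˡ : ∀ i j → (inverse ∙ₘ U) i j ≡ 1ₘ {n} i j
      inverseʳ : ∀ i j → (U ∙ₘ inverse) i j ≡ 1ₘ {n} i j

  -- D is in Smith normal form, and its nonzero diagonal entries are
  -- d 0 ∣ d 1 ∣ ⋯ ∣ d (r - 1), all positive; D need not be square.
  record IsSmith {l n r} (D : Matrix ℤ l n) (d : Vector ℕ r) : Set where
    field
      r≤l         : r ≤ l
      r≤n         : r ≤ n
      offDiagonal : ∀ i j → toℕ i ≢ toℕ j → D i j ≡ 0ℤ
      diagonal    : ∀ k → D (inject≤ k r≤l) (inject≤ k r≤n) ≡ + d k
      beyondRank  : ∀ i j → toℕ i ≡ toℕ j → r ≤ toℕ i → D i j ≡ 0ℤ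
      positive    : ∀ k → 0 < d k
      divides     : ∀ k k′ → toℕ k′ ≡ suc (toℕ k) → d k ∣ d k′

  -- Smith normal forms are taken with respect to multiplication on either
  -- side by matrices invertible over ℤ. The length r of d is the rank of B.
  record InvariantFactors {l n r} (B : Matrix ℤ l n) (d : Vector ℕ r) : Set where
    field
      left            : Matrix ℤ l l
      right           : Matrix ℤ n n
      normalForm      : Matrix ℤ l n
      leftInvertible  : Invertible left
      rightInvertible : Invertible right
      equivalent      : ∀ i j → (left ∙ₘ B ∙ₘ right) i j ≡ normalForm i j
      isSmith         : IsSmith normalForm d

module _ (q : ℕ) .{{_ : NonZero q}} where

  -- ℤ/qℤ is represented by the residues 0, …, q - 1, so that its equality
  -- is propositional equality.
  reduce : ℤ → Fin q
  reduce z = fromℕ< (n%ℕd<d z q)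

  ℤ/-rawSemiring : RawSemiring 0ℓ 0ℓ
  ℤ/-rawSemiring = record
    { Carrier = Fin q
    ; _≈_     = _≡_
    ; _+_     = λ x y → reduce (+ toℕ x ℤ.+ + toℕ y)
    ; _*_     = λ x y → reduce (+ toℕ x ℤ.* + toℕ y)
    ; 0#      = reduce (+ 0)
    ; 1#      = reduce (+ 1)
    }

  open LinearAlgebra ℤ/-rawSemiring

  reduceᵥ : ∀ {n} → Vector ℤ n → Vector (Fin q) n
  reduceᵥ v i = reduce (v i)

  reduceₘ : ∀ {m n} → Matrix ℤ m n → Matrix (Fin q) m n
  reduceₘ M i = reduceᵥ (M i)

  Col : ∀ {l n} → Matrix ℤ l n → Pred (Vector (Fin q) l) 0ℓ
  Col B = Span (column (reduceₘ B))

  module _ {l m n} (A : Matrix ℤ m n) (a : Vector ℤ m)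
                   (B : Matrix ℤ l n) (b : Vector ℤ l) where

    V : Pred (Vector (Fin q) n) 0ℓ
    V x = ∀ k → (reduceₘ B ∙ᵥ x) k ≡ reduceᵥ b k

    H : Fin m → Pred (Vector (Fin q) n) 0ℓ
    H i = V ∩ λ x → reduceᵥ (A i) · x ≡ reduce (a i)

    M : Pred (Vector (Fin q) n) 0ℓ
    M = V ∖ ⋃ (Fin m) H

    V? : Decidable V
    V? x = Fin.all? λ k → (reduceₘ B ∙ᵥ x) k Fin.≟ reduceᵥ b k

    H? : ∀ i → Decidable (H i)
    H? i x = V? x ×-dec (reduceᵥ (A i) · x Fin.≟ reduce (a i))

    M? : Decidable M
    M? x = V? x ×-dec ¬? (Fin.any? λ i → H? i x)

    -- finToFun is a bijection from Fin (q ^ n) to the vectors of length n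
    -- over ℤ/qℤ (up to pointwise equality), so each of them is listed
    -- exactly once.
    #M : ℕ
    #M = Vec.count M? (Vec.tabulate {n = q ^ n} finToFun)

{-# OPTIONS --safe #-}
module Submission where

-- If reduction modulo q maps V_pq onto V_q, then every point of M(𝒜_q) has a preimage in
-- M(𝒜_pq), because the reduction of H_{i,pq} is contained in H_{i,q}. Since
-- V_pq contains some x₀, it suffices to lift ker [B]_q to ker [B]_pq. The Smith normal form
-- decouples this into one problem per coordinate: given q ∣ d y, find t with
-- pq ∣ d (y + q t). It is solvable for every such y because gcd(p,d) gcd(q,d) ∣ d.
-- Without equations there is nothing to lift.

open import Defs
open import Data.Integer.Base using (ℤ)
open import Data.Nat.Base using (ℕ; NonZero; _*_; _≤_)
open import Data.Nat.Divisibility using (_∣_)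
open import Data.Nat.GCD using (gcd)
open import Data.Nat.Properties using (m*n≢0)
open import Data.Product.Base using (_×_)
open import Data.Vec.Functional using (Vector)
open import Relation.Binary.PropositionalEquality using (_≡_)

import Algebra.Properties.Semiring.Sum as Sum
open import Data.Fin.Base using (Fin; zero; suc; toℕ; fromℕ<; inject≤; finToFun; funToFin; combine)
import Data.Fin.Properties as Fin
open import Data.Integer.Base as ℤ using (+_; 0ℤ; -_)
open import Data.Integer.DivMod using (n%ℕd<d; a≡a%ℕn+[a/ℕn]*n)
import Data.Integer.Divisibility.Signed as ℤ
import Data.Integer.Properties as ℤ
open import Data.Integer.Tactic.RingSolver using (solve-∀)
open import Data.Nat.Base as ℕ using (_<_; _^_)
import Data.Nat.Divisibility as ℕ
open import Data.Nat.GCD using (gcd-GCD; module Bézout; gcd[m,n]≡0⇒n≡0)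
import Data.Nat.Properties as ℕ
open import Data.Product.Base using (∃; _,_; proj₁; proj₂)
open import Data.Vec.Base as Vec using (Vec; []; _∷_)
import Data.Vec.Properties as Vec
open import Function.Base using (_∘_)
open import Function.Definitions using (Injective)
open import Level using (0ℓ)
open import Relation.Binary.PropositionalEquality
  using (_≢_; _≗_; refl; sym; trans; cong; cong₂; subst; module ≡-Reasoning)
open import Relation.Nullary using (¬_; yes; no; contradiction)
open import Relation.Unary using (Pred; Decidable; ⋃)

open ℤLin
open Sum ℤ.+-*-semiring
  using (sum-cong-≗; ∑-distrib-+; ∑-comm; *-distribˡ-sum; *-distribʳ-sum; sum-replicate-zero)

-- Comparing counts.

record Enumeration {A : Set} (P : Pred A 0ℓ) {n} (xs : Vec A n) (c : ℕ) : Set where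
  field
    position   : Fin c → Fin n
    satisfies  : ∀ k → P (Vec.lookup xs (position k))
    injective  : Injective _≡_ _≡_ position
    surjective : ∀ i → P (Vec.lookup xs i) → ∃ λ k → position k ≡ i

-- Turns a count into a bijection from `Fin c` onto the satisfying positions, so that counts can be
-- compared through maps. Positions are used instead of entries because the entries to be counted
-- are functions, which are compared only pointwise.
count-enumeration : ∀ {A : Set} {P : Pred A 0ℓ} (P? : Decidable P) {n} (xs : Vec A n) →
                    Enumeration P xs (Vec.count P? xs)
count-enumeration P? [] = record
  { position   = λ ()
  ; satisfies  = λ ()
  ; injective  = λ { {()} }
  ; surjective = λ ()
  }
count-enumeration P? (x ∷ xs) with P? x | count-enumeration P? xs
... | yes px | e = record
  { position   = λ { zero → zero ; (suc k) → suc (position k) }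
  ; satisfies  = λ { zero → px ; (suc k) → satisfies k }
  ; injective  = λ { {zero}  {zero}  _  → refl
                   ; {suc _} {suc _} eq → cong suc (injective (Fin.suc-injective eq)) }
  ; surjective = λ { zero    _ → zero , refl
                   ; (suc i) p → let k , eq = surjective i p in suc k , cong suc eq }
  }
  where open Enumeration e
... | no ¬px | e = record
  { position   = suc ∘ position
  ; satisfies  = satisfies
  ; injective  = injective ∘ Fin.suc-injective
  ; surjective = λ { zero    p → contradiction p ¬px
                   ; (suc i) p → let k , eq = surjective i p in k , cong suc eq }
  }
  where open Enumeration e

-- Choosing for each satisfying position of `xs` a satisfying preimage under `f` is automatically
-- injective, since `f` recovers the position from the choice.
count-≤ : ∀ {A B : Set} {P : Pred A 0ℓ} {Q : Pred B 0ℓ} (P? : Decidable P) (Q? : Decidable Q)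
          {m n} (xs : Vec A m) (ys : Vec B n) (f : Fin n → Fin m) →
          (∀ i → P (Vec.lookup xs i) → ∃ λ j → Q (Vec.lookup ys j) × f j ≡ i) →
          Vec.count P? xs ≤ Vec.count Q? ys
count-≤ P? Q? xs ys f lift = Fin.injective⇒≤ {f = proj₁ ∘ g} g-injective
  where
  module P = Enumeration (count-enumeration P? xs)
  module Q = Enumeration (count-enumeration Q? ys)

  g : ∀ k → ∃ λ k′ → f (Q.position k′) ≡ P.position k
  g k with j , q , fj≡i ← lift (P.position k) (P.satisfies k)
      with k′ , eq ← Q.surjective j q = k′ , trans (cong f eq) fj≡i

  g-injective : Injective _≡_ _≡_ (proj₁ ∘ g)
  g-injective {j} {k} eq = P.injective
    (trans (sym (proj₂ (g j))) (trans (cong (f ∘ Q.position) eq) (proj₂ (g k))))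

-- Needed because the encoded vectors are only known to agree pointwise, which `cong` cannot use.
funToFin-cong : ∀ {m n} {f g : Fin m → Fin n} → f ≗ g → funToFin f ≡ funToFin g
funToFin-cong {ℕ.zero}  f≗g = refl
funToFin-cong {ℕ.suc m} f≗g = cong₂ combine (f≗g zero) (funToFin-cong (f≗g ∘ suc))

-- Integer vectors and matrices.

·-congʳ : ∀ {n} (w : Vector ℤ n) {u v} → u ≗ v → w · u ≡ w · v
·-congʳ w u≗v = sum-cong-≗ λ j → cong (w j ℤ.*_) (u≗v j)

·-comm : ∀ {n} (u v : Vector ℤ n) → u · v ≡ v · u
·-comm u v = sum-cong-≗ λ j → ℤ.*-comm (u j) (v j)

·-distribˡ-+ : ∀ {n} (w u v : Vector ℤ n) → w · (λ j → u j ℤ.+ v j) ≡ w · u ℤ.+ w · v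
·-distribˡ-+ w u v =
  trans (sum-cong-≗ λ j → ℤ.*-distribˡ-+ (w j) (u j) (v j))
        (∑-distrib-+ (λ j → w j ℤ.* u j) (λ j → w j ℤ.* v j))

-- Follows from additivity by adding `v` back, so no separate law for negation is required.
·-distribˡ-- : ∀ {n} (w u v : Vector ℤ n) → w · (λ j → u j ℤ.- v j) ≡ w · u ℤ.- w · v
·-distribˡ-- w u v = begin
  w · (λ j → u j ℤ.- v j)
    ≡⟨ cancelʳ (w · (λ j → u j ℤ.- v j)) (w · v) ⟨
  w · (λ j → u j ℤ.- v j) ℤ.+ w · v ℤ.- w · v
    ≡⟨ cong (ℤ._- w · v) (·-distribˡ-+ w (λ j → u j ℤ.- v j) v) ⟨
  w · (λ j → u j ℤ.- v j ℤ.+ v j) ℤ.- w · v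
    ≡⟨ cong (ℤ._- w · v) (·-congʳ w λ j → cancel (u j) (v j)) ⟩
  w · u ℤ.- w · v ∎
  where
  open ≡-Reasoning
  cancel : ∀ x y → x ℤ.- y ℤ.+ y ≡ x
  cancel = solve-∀
  cancelʳ : ∀ x y → x ℤ.+ y ℤ.- y ≡ x
  cancelʳ = solve-∀

∙ₘ-∙ᵥ-assoc : ∀ {k m n} (M : Matrix ℤ k m) (N : Matrix ℤ m n) x →
              (M ∙ₘ N) ∙ᵥ x ≗ M ∙ᵥ (N ∙ᵥ x)
∙ₘ-∙ᵥ-assoc M N x i = begin
  sum (λ j → sum (λ k → M i k ℤ.* N k j) ℤ.* x j)
    ≡⟨ sum-cong-≗ (λ j → *-distribʳ-sum (x j) (λ k → M i k ℤ.* N k j)) ⟩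
  sum (λ j → sum (λ k → M i k ℤ.* N k j ℤ.* x j))
    ≡⟨ ∑-comm (λ j k → M i k ℤ.* N k j ℤ.* x j) ⟩
  sum (λ k → sum (λ j → M i k ℤ.* N k j ℤ.* x j))
    ≡⟨ sum-cong-≗ (λ k → sum-cong-≗ λ j → ℤ.*-assoc (M i k) (N k j) (x j)) ⟩
  sum (λ k → sum (λ j → M i k ℤ.* (N k j ℤ.* x j)))
    ≡⟨ sum-cong-≗ (λ k → *-distribˡ-sum (M i k) (λ j → N k j ℤ.* x j)) ⟨
  sum (λ k → M i k ℤ.* (N k · x)) ∎
  where open ≡-Reasoning

sum-zero : ∀ {n} {f : Vector ℤ n} → (∀ j → f j ≡ 0ℤ) → sum f ≡ 0ℤ
sum-zero {n} f≡0 = trans (sum-cong-≗ f≡0) (sum-replicate-zero n)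

sum-single : ∀ {n} (f : Vector ℤ n) i → (∀ j → i ≢ j → f j ≡ 0ℤ) → sum f ≡ f i
sum-single f zero    f≡0 =
  trans (cong (λ z → f zero ℤ.+ z) (sum-zero λ j → f≡0 (suc j) λ ())) (ℤ.+-identityʳ _)
sum-single f (suc i) f≡0 =
  trans (cong₂ ℤ._+_ (f≡0 zero λ ())
                     (sum-single (f ∘ suc) i λ j i≢j → f≡0 (suc j) (i≢j ∘ Fin.suc-injective)))
        (ℤ.+-identityˡ _)

1ₘ-∙ᵥ : ∀ {n} (x : Vector ℤ n) → 1ₘ ∙ᵥ x ≗ x
1ₘ-∙ᵥ x i = trans (sum-single _ i off) on
  where
  off : ∀ j → i ≢ j → 1ₘ i j ℤ.* x j ≡ 0ℤ
  off j i≢j with i Fin.≟ j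
  ... | yes i≡j = contradiction i≡j i≢j
  ... | no  _   = refl

  on : 1ₘ i i ℤ.* x i ≡ x i
  on with i Fin.≟ i
  ... | yes _   = ℤ.*-identityˡ (x i)
  ... | no  i≢i = contradiction refl i≢i

-- Asking for a one-sided inverse lets this serve both for `right` followed by `right⁻¹` as a
-- product and for `left⁻¹` times `left`.
∙ₘ-inverse-∙ᵥ : ∀ {n} (M N : Matrix ℤ n n) → (∀ i j → (M ∙ₘ N) i j ≡ 1ₘ {n} i j) →
                ∀ x → M ∙ᵥ (N ∙ᵥ x) ≗ x
∙ₘ-inverse-∙ᵥ M N MN≡1 x i = begin
  (M ∙ᵥ (N ∙ᵥ x)) i ≡⟨ ∙ₘ-∙ᵥ-assoc M N x i ⟨
  ((M ∙ₘ N) ∙ᵥ x) i ≡⟨ sum-cong-≗ (λ j → cong (ℤ._* x j) (MN≡1 i j)) ⟩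
  (1ₘ ∙ᵥ x) i       ≡⟨ 1ₘ-∙ᵥ x i ⟩
  x i               ∎
  where open ≡-Reasoning

-- Divisibility and lifting in one coordinate.

∣-sum : ∀ {k n} {f : Vector ℤ n} → (∀ j → k ℤ.∣ f j) → k ℤ.∣ sum f
∣-sum {n = ℕ.zero}  k∣f = ℤ.divides 0ℤ refl
∣-sum {n = ℕ.suc n} k∣f = ℤ.∣m∣n⇒∣m+n (k∣f zero) (∣-sum (k∣f ∘ suc))

∣-· : ∀ {k n} (w : Vector ℤ n) {v} → (∀ j → k ℤ.∣ v j) → k ℤ.∣ w · v
∣-· w k∣v = ∣-sum λ j → ℤ.∣n⇒∣m*n (w j) (k∣v j)

-- Over the natural numbers the identity has two forms, according to which multiple is the larger;
-- signed coefficients merge them.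
bézout : ∀ m n → ∃ λ u → ∃ λ v → u ℤ.* + m ℤ.+ v ℤ.* + n ≡ + gcd m n
bézout m n with Bézout.identity (gcd-GCD m n)
... | Bézout.+- x y eq = + x , - + y , lemma (+ gcd m n) (+ x ℤ.* + m) (+ y) (+ n)
      (trans (cong (λ z → + gcd m n ℤ.+ z) (sym (ℤ.pos-* y n)))
             (trans (cong +_ eq) (ℤ.pos-* x m)))
  where
  identity : ∀ g y n → g ℤ.+ y ℤ.* n ℤ.+ - y ℤ.* n ≡ g
  identity = solve-∀
  lemma : ∀ g s y n → g ℤ.+ y ℤ.* n ≡ s → s ℤ.+ - y ℤ.* n ≡ g
  lemma g s y n refl = identity g y n
... | Bézout.-+ x y eq = - + x , + y , lemma (+ gcd m n) (+ y ℤ.* + n) (+ x) (+ m)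
      (trans (cong (λ z → + gcd m n ℤ.+ z) (sym (ℤ.pos-* x m)))
             (trans (cong +_ eq) (ℤ.pos-* y n)))
  where
  identity : ∀ g x m → - x ℤ.* m ℤ.+ (g ℤ.+ x ℤ.* m) ≡ g
  identity = solve-∀
  lemma : ∀ g s x m → g ℤ.+ x ℤ.* m ≡ s → - x ℤ.* m ℤ.+ s ≡ g
  lemma g s x m refl = identity g x m

-- In the situation d = egh, dy = sq below, sh = u′sq + v′sd = u′dy + v′sd is divisible by d,
-- so g ∣ s, and p ∣ s + dt is solvable for t.
∣-lift-bézout : ∀ (p q d e g h u v u′ v′ : ℤ) .{{_ : ℤ.NonZero h}} → d ≡ e ℤ.* (g ℤ.* h) →
                u ℤ.* p ℤ.+ v ℤ.* d ≡ g → u′ ℤ.* q ℤ.+ v′ ℤ.* d ≡ h →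
                ∀ y → q ℤ.∣ d ℤ.* y → ∃ λ t → p ℤ.* q ℤ.∣ d ℤ.* (y ℤ.+ q ℤ.* t)
∣-lift-bézout p q d e g h u v u′ v′ d≡egh up+vd≡g u′q+v′d≡h y (ℤ.divides s dy≡sq) =
  -- Since `d y = s q`, the target is `q (s + d t)`. Writing `s = s′ g = s′ u p + s′ v d` shows that
  -- `t = - s′ v` cancels the term with `d` and leaves the quotient `s′ u`.
  - (s′ ℤ.* v) , ℤ.divides (s′ ℤ.* u) (begin
    d ℤ.* (y ℤ.+ q ℤ.* - (s′ ℤ.* v))          ≡⟨ expand d y q s′ v ⟩
    d ℤ.* y ℤ.- q ℤ.* s′ ℤ.* (v ℤ.* d)        ≡⟨ cong (λ z → z ℤ.- q ℤ.* s′ ℤ.* (v ℤ.* d)) dy≡sq ⟩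
    s ℤ.* q ℤ.- q ℤ.* s′ ℤ.* (v ℤ.* d)        ≡⟨ cong (λ z → z ℤ.* q ℤ.- q ℤ.* s′ ℤ.* (v ℤ.* d)) s≡s′g ⟩
    s′ ℤ.* g ℤ.* q ℤ.- q ℤ.* s′ ℤ.* (v ℤ.* d) ≡⟨ cong (λ z → s′ ℤ.* z ℤ.* q ℤ.- q ℤ.* s′ ℤ.* (v ℤ.* d)) up+vd≡g ⟨
    s′ ℤ.* (u ℤ.* p ℤ.+ v ℤ.* d) ℤ.* q ℤ.- q ℤ.* s′ ℤ.* (v ℤ.* d)
                                              ≡⟨ contract s′ u v p q d ⟩
    s′ ℤ.* u ℤ.* (p ℤ.* q)                    ∎)
  where
  open ≡-Reasoning
  -- The quotient of `s` by `g`, read off from `s h = d (u′ y + v′ s)` by replacing `d` with `e g h`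
  -- and cancelling `h`.
  s′ = e ℤ.* (u′ ℤ.* y ℤ.+ v′ ℤ.* s)

  expand : ∀ d y q s v → d ℤ.* (y ℤ.+ q ℤ.* - (s ℤ.* v)) ≡ d ℤ.* y ℤ.- q ℤ.* s ℤ.* (v ℤ.* d)
  expand = solve-∀

  contract : ∀ s u v p q d →
    s ℤ.* (u ℤ.* p ℤ.+ v ℤ.* d) ℤ.* q ℤ.- q ℤ.* s ℤ.* (v ℤ.* d) ≡ s ℤ.* u ℤ.* (p ℤ.* q)
  contract = solve-∀

  regroup₁ : ∀ s u v q d → s ℤ.* (u ℤ.* q ℤ.+ v ℤ.* d) ≡ u ℤ.* (s ℤ.* q) ℤ.+ v ℤ.* s ℤ.* d
  regroup₁ = solve-∀

  regroup₂ : ∀ e g h u v y s →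
    u ℤ.* (e ℤ.* (g ℤ.* h) ℤ.* y) ℤ.+ v ℤ.* s ℤ.* (e ℤ.* (g ℤ.* h)) ≡
    e ℤ.* (u ℤ.* y ℤ.+ v ℤ.* s) ℤ.* g ℤ.* h
  regroup₂ = solve-∀

  s≡s′g : s ≡ s′ ℤ.* g
  s≡s′g = ℤ.*-cancelʳ-≡ s (s′ ℤ.* g) h (begin
    s ℤ.* h                             ≡⟨ cong (s ℤ.*_) u′q+v′d≡h ⟨
    s ℤ.* (u′ ℤ.* q ℤ.+ v′ ℤ.* d)       ≡⟨ regroup₁ s u′ v′ q d ⟩
    u′ ℤ.* (s ℤ.* q) ℤ.+ v′ ℤ.* s ℤ.* d ≡⟨ cong (λ z → u′ ℤ.* z ℤ.+ v′ ℤ.* s ℤ.* d) dy≡sq ⟨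
    u′ ℤ.* (d ℤ.* y) ℤ.+ v′ ℤ.* s ℤ.* d
      ≡⟨ cong (λ z → u′ ℤ.* (z ℤ.* y) ℤ.+ v′ ℤ.* s ℤ.* z) d≡egh ⟩
    u′ ℤ.* (e ℤ.* (g ℤ.* h) ℤ.* y) ℤ.+ v′ ℤ.* s ℤ.* (e ℤ.* (g ℤ.* h))
                                        ≡⟨ regroup₂ e g h u′ v′ y s ⟩
    s′ ℤ.* g ℤ.* h                      ∎)

-- Positivity of an invariant factor enters here: it permits cancelling `gcd q d` in
-- `∣-lift-bézout`.
gcd≢0 : ∀ m n → 0 < n → ℕ.NonZero (gcd m n)
gcd≢0 m n 0<n = ℕ.≢-nonZero λ eq → ℕ.<⇒≢ 0<n (sym (gcd[m,n]≡0⇒n≡0 m eq))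

∣-lift : ∀ p q d → 0 < d → gcd p d * gcd q d ∣ d → ∀ y → + q ℤ.∣ + d ℤ.* y →
         ∃ λ t → + (p * q) ℤ.∣ + d ℤ.* (y ℤ.+ + q ℤ.* t)
∣-lift p q d 0<d (ℕ.divides e d≡egh) y q∣dy =
  let u  , v  , up+vd≡g   = bézout p d
      u′ , v′ , u′q+v′d≡h = bézout q d
      t  , pq∣d[y+qt]     = ∣-lift-bézout (+ p) (+ q) (+ d) (+ e) (+ gcd p d) (+ gcd q d) u v u′ v′
                              {{gcd≢0 q d 0<d}} d≡eghᶻ up+vd≡g u′q+v′d≡h y q∣dy
  in t , subst (ℤ._∣ + d ℤ.* (y ℤ.+ + q ℤ.* t)) (sym (ℤ.pos-* p q)) pq∣d[y+qt]
  where
  d≡eghᶻ : + d ≡ + e ℤ.* (+ gcd p d ℤ.* + gcd q d)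
  d≡eghᶻ = trans (cong +_ d≡egh)
    (trans (ℤ.pos-* e _) (cong (+ e ℤ.*_) (ℤ.pos-* (gcd p d) _)))

-- Lifting the kernel through the Smith normal form.

module _ {l n r} {B : Matrix ℤ l n} {d : Vector ℕ r} (inv : InvariantFactors B d) where

  open InvariantFactors inv
  open IsSmith isSmith
  open Invertible leftInvertible renaming (inverse to left⁻¹; inverseˡ to left⁻¹-inverseˡ) using ()
  open Invertible rightInvertible renaming (inverse to right⁻¹; inverseʳ to right⁻¹-inverseʳ) using ()

  normalForm-∙ᵥ : ∀ y → normalForm ∙ᵥ y ≗ left ∙ᵥ (B ∙ᵥ (right ∙ᵥ y))
  normalForm-∙ᵥ y i = begin
    (normalForm ∙ᵥ y) i                 ≡⟨ sum-cong-≗ (λ j → cong (ℤ._* y j) (equivalent i j)) ⟨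
    (left ∙ₘ B ∙ₘ right ∙ᵥ y) i         ≡⟨ ∙ₘ-∙ᵥ-assoc (left ∙ₘ B) right y i ⟩
    (left ∙ₘ B ∙ᵥ (right ∙ᵥ y)) i       ≡⟨ ∙ₘ-∙ᵥ-assoc left B (right ∙ᵥ y) i ⟩
    (left ∙ᵥ (B ∙ᵥ (right ∙ᵥ y))) i     ∎
    where open ≡-Reasoning

  normalForm-diagonal : ∀ y k →
    (normalForm ∙ᵥ y) (inject≤ k r≤l) ≡ + d k ℤ.* y (inject≤ k r≤n)
  normalForm-diagonal y k = trans
    (sum-single _ (inject≤ k r≤n) λ j k≢j → cong (ℤ._* y j) (offDiagonal _ j λ eq →
      k≢j (Fin.toℕ-injective (trans (Fin.toℕ-inject≤ k r≤n) (trans (sym (Fin.toℕ-inject≤ k r≤l)) eq)))))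
    (cong (ℤ._* y (inject≤ k r≤n)) (diagonal k))

  normalForm-beyond : ∀ y i → r ≤ toℕ i → (normalForm ∙ᵥ y) i ≡ 0ℤ
  normalForm-beyond y i r≤i = sum-zero λ j → cong (ℤ._* y j) (zeroEntry j)
    where
    zeroEntry : ∀ j → normalForm i j ≡ 0ℤ
    zeroEntry j with toℕ i ℕ.≟ toℕ j
    ... | yes i≡j = beyondRank i j i≡j r≤i
    ... | no  i≢j = offDiagonal i j i≢j

  -- In the coordinates `y` with `right ∙ᵥ y` equal to `z`, the system is diagonal and each
  -- coordinate is corrected separately by a multiple of `q`. Integer matrices preserve divisibility
  -- of all entries, so `left` carries the hypothesis to the normal form and `left⁻¹` carries the
  -- conclusion back to `B`.
  kernel-lift : ∀ p q → (∀ i → gcd p (d i) * gcd q (d i) ∣ d i) →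
                ∀ z → (∀ i → + q ℤ.∣ (B ∙ᵥ z) i) →
                ∃ λ e → (∀ j → + q ℤ.∣ e j) × (∀ i → + (p * q) ℤ.∣ (B ∙ᵥ (λ j → z j ℤ.+ e j)) i)
  kernel-lift p q gcds∣d z q∣Bz = e , q∣e , pq∣B[z+e]
    where
    y = right⁻¹ ∙ᵥ z

    right-y : right ∙ᵥ y ≗ z
    right-y = ∙ₘ-inverse-∙ᵥ right right⁻¹ right⁻¹-inverseʳ z

    q∣Dy : ∀ i → + q ℤ.∣ (normalForm ∙ᵥ y) i
    q∣Dy i = subst (+ q ℤ.∣_)
      (sym (trans (normalForm-∙ᵥ y i) (·-congʳ (left i) λ k → ·-congʳ (B k) right-y)))
      (∣-· (left i) q∣Bz)

    t-diagonal : ∀ k → ∃ λ t → + (p * q) ℤ.∣ + d k ℤ.* (y (inject≤ k r≤n) ℤ.+ + q ℤ.* t)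
    t-diagonal k = ∣-lift p q (d k) (positive k) (gcds∣d k) _
      (subst (+ q ℤ.∣_) (normalForm-diagonal y k) (q∣Dy _))

    t : Vector ℤ n
    t j with toℕ j ℕ.<? r
    ... | yes j<r = proj₁ (t-diagonal (fromℕ< j<r))
    -- The columns of `normalForm` from index `r` on vanish, so these coordinates are unconstrained
    -- and need no correction.
    ... | no  _   = 0ℤ

    t-inject≤ : ∀ k → t (inject≤ k r≤n) ≡ proj₁ (t-diagonal k)
    t-inject≤ k with toℕ (inject≤ k r≤n) ℕ.<? r
    ... | yes k<r = cong (proj₁ ∘ t-diagonal)
      (Fin.toℕ-injective (trans (Fin.toℕ-fromℕ< k<r) (Fin.toℕ-inject≤ k r≤n)))
    ... | no  k≮r = contradiction (subst (_< r) (sym (Fin.toℕ-inject≤ k r≤n)) (Fin.toℕ<n k)) k≮r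

    y′ : Vector ℤ n
    y′ j = y j ℤ.+ + q ℤ.* t j

    pq∣Dy′ : ∀ i → + (p * q) ℤ.∣ (normalForm ∙ᵥ y′) i
    pq∣Dy′ i with toℕ i ℕ.<? r
    ... | no  i≮r = subst (_ ℤ.∣_) (sym (normalForm-beyond y′ i (ℕ.≮⇒≥ i≮r))) (ℤ.divides 0ℤ refl)
    ... | yes i<r = subst (λ i → _ ℤ.∣ (normalForm ∙ᵥ y′) i) k≡i
      (subst (_ ℤ.∣_) (sym (normalForm-diagonal y′ k))
        (subst (λ t → _ ℤ.∣ + d k ℤ.* (y (inject≤ k r≤n) ℤ.+ + q ℤ.* t)) (sym (t-inject≤ k)) (proj₂ (t-diagonal k))))
      where
      k = fromℕ< i<r
      k≡i : inject≤ k r≤l ≡ i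
      k≡i = Fin.toℕ-injective (trans (Fin.toℕ-inject≤ k r≤l) (Fin.toℕ-fromℕ< i<r))

    -- The correction `q t` transported to the original coordinates: by linearity `right` sends `y′`
    -- to `z + e`, and every entry of `e` keeps the factor `q`.
    e : Vector ℤ n
    e = right ∙ᵥ (λ j → + q ℤ.* t j)

    q∣e : ∀ j → + q ℤ.∣ e j
    q∣e j = ∣-· (right j) λ k → ℤ.∣m⇒∣m*n (t k) ℤ.∣-refl

    right-y′ : right ∙ᵥ y′ ≗ λ j → z j ℤ.+ e j
    right-y′ j = trans (·-distribˡ-+ (right j) y _) (cong (ℤ._+ e j) (right-y j))

    pq∣B[z+e] : ∀ i → + (p * q) ℤ.∣ (B ∙ᵥ (λ j → z j ℤ.+ e j)) i
    pq∣B[z+e] i = subst (_ ℤ.∣_)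
      (trans (∙ₘ-inverse-∙ᵥ left⁻¹ left left⁻¹-inverseˡ (B ∙ᵥ (right ∙ᵥ y′)) i)
             (·-congʳ (B i) right-y′))
      (∣-· (left⁻¹ i) λ k → subst (_ ℤ.∣_) (normalForm-∙ᵥ y′ k) (pq∣Dy′ k))

-- Congruences between integers.

infix 4 _≈_[mod_]

-- A record rather than an abbreviation, so that x and y can be inferred.
record _≈_[mod_] (x y : ℤ) (k : ℕ) : Set where
  constructor ∣⇒≈
  field
    ≈⇒∣ : + k ℤ.∣ x ℤ.- y

open _≈_[mod_]

module _ {k : ℕ} where

  ≈-refl : ∀ {x} → x ≈ x [mod k ]
  ≈-refl {x} = ∣⇒≈ (ℤ.divides 0ℤ (ℤ.+-inverseʳ x))

  ≈-reflexive : ∀ {x y} → x ≡ y → x ≈ y [mod k ]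
  ≈-reflexive refl = ≈-refl

  ≈-sym : ∀ {x y} → x ≈ y [mod k ] → y ≈ x [mod k ]
  ≈-sym {x} {y} (∣⇒≈ k∣) = ∣⇒≈ (subst (+ k ℤ.∣_) (identity x y) (ℤ.∣m⇒∣-m k∣))
    where
    identity : ∀ x y → - (x ℤ.- y) ≡ y ℤ.- x
    identity = solve-∀

  ≈-trans : ∀ {x y z} → x ≈ y [mod k ] → y ≈ z [mod k ] → x ≈ z [mod k ]
  ≈-trans {x} {y} {z} (∣⇒≈ k∣) (∣⇒≈ k∣′) =
    ∣⇒≈ (subst (+ k ℤ.∣_) (identity x y z) (ℤ.∣m∣n⇒∣m+n k∣ k∣′))
    where
    identity : ∀ x y z → (x ℤ.- y) ℤ.+ (y ℤ.- z) ≡ x ℤ.- z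
    identity = solve-∀

  ≈-+-cong : ∀ {x x′ y y′} → x ≈ x′ [mod k ] → y ≈ y′ [mod k ] → x ℤ.+ y ≈ x′ ℤ.+ y′ [mod k ]
  ≈-+-cong {x} {x′} {y} {y′} (∣⇒≈ k∣) (∣⇒≈ k∣′) =
    ∣⇒≈ (subst (+ k ℤ.∣_) (identity x x′ y y′) (ℤ.∣m∣n⇒∣m+n k∣ k∣′))
    where
    identity : ∀ x x′ y y′ → (x ℤ.- x′) ℤ.+ (y ℤ.- y′) ≡ (x ℤ.+ y) ℤ.- (x′ ℤ.+ y′)
    identity = solve-∀

  ≈-*-cong : ∀ {x x′ y y′} → x ≈ x′ [mod k ] → y ≈ y′ [mod k ] → x ℤ.* y ≈ x′ ℤ.* y′ [mod k ]
  ≈-*-cong {x} {x′} {y} {y′} (∣⇒≈ k∣) (∣⇒≈ k∣′) =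
    ∣⇒≈ (subst (+ k ℤ.∣_) (identity x x′ y y′)
      (ℤ.∣m∣n⇒∣m+n (ℤ.∣m⇒∣m*n y k∣) (ℤ.∣n⇒∣m*n x′ k∣′)))
    where
    identity : ∀ x x′ y y′ → (x ℤ.- x′) ℤ.* y ℤ.+ x′ ℤ.* (y ℤ.- y′) ≡ x ℤ.* y ℤ.- x′ ℤ.* y′
    identity = solve-∀

  ≈-sum-cong : ∀ {n} {f g : Vector ℤ n} → (∀ j → f j ≈ g j [mod k ]) → sum f ≈ sum g [mod k ]
  ≈-sum-cong {ℕ.zero}  f≈g = ≈-refl
  ≈-sum-cong {ℕ.suc n} f≈g = ≈-+-cong (f≈g zero) (≈-sum-cong (f≈g ∘ suc))

  ≈-·-congˡ : ∀ {n} (w : Vector ℤ n) {x y} → (∀ j → x j ≈ y j [mod k ]) → w · x ≈ w · y [mod k ]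
  ≈-·-congˡ w x≈y = ≈-sum-cong λ j → ≈-*-cong (≈-refl {x = w j}) (x≈y j)

  ≈-·-congʳ : ∀ {n} (x : Vector ℤ n) {v w} → (∀ j → v j ≈ w j [mod k ]) → v · x ≈ w · x [mod k ]
  ≈-·-congʳ x v≈w = ≈-sum-cong λ j → ≈-*-cong (v≈w j) (≈-refl {x = x j})

≈-weaken : ∀ {k k′ x y} → k ∣ k′ → x ≈ y [mod k′ ] → x ≈ y [mod k ]
≈-weaken k∣k′ (∣⇒≈ k′∣) = ∣⇒≈ (ℤ.∣-trans (ℤ.∣ᵤ⇒∣ k∣k′) k′∣)

-- Passing to integer representatives makes vectors over different moduli comparable.
⟦_⟧ : ∀ {q n} → Vector (Fin q) n → Vector ℤ n
⟦ x ⟧ j = + toℕ (x j)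

-- Two residues below `q` differ by less than `q` in absolute value, and the only multiple of `q`
-- that small is zero.
residue-unique : ∀ {q} {i j : Fin q} → + toℕ i ≈ + toℕ j [mod q ] → i ≡ j
residue-unique {q} {i} {j} (∣⇒≈ q∣i-j) =
  Fin.toℕ-injective (ℤ.+-injective (ℤ.i-j≡0⇒i≡j _ _ (ℤ.∣i∣≡0⇒i≡0 ∣i-j∣≡0)))
  where
  ∣i-j∣<q : ℤ.∣ + toℕ i ℤ.- + toℕ j ∣ < q
  ∣i-j∣<q = subst (λ z → ℤ.∣ z ∣ < q) (sym (ℤ.m-n≡m⊖n (toℕ i) (toℕ j)))
    (ℕ.≤-<-trans (ℤ.∣m⊝n∣≤m⊔n (toℕ i) (toℕ j)) (ℕ.⊔-pres-<m (Fin.toℕ<n i) (Fin.toℕ<n j)))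

  ∣i-j∣≡0 : ℤ.∣ + toℕ i ℤ.- + toℕ j ∣ ≡ 0
  ∣i-j∣≡0 with ℤ.∣ + toℕ i ℤ.- + toℕ j ∣ | ∣i-j∣<q | ℤ.∣⇒∣ᵤ q∣i-j
  ... | ℕ.zero  | _   | _   = refl
  ... | ℕ.suc _ | m<q | q∣m = contradiction q∣m (ℕ.>⇒∤ m<q)

-- Arithmetic of residues as integer congruences.

module _ (q : ℕ) .{{_ : NonZero q}} where

  module ℤ/q = LinearAlgebra (ℤ/-rawSemiring q)

  toℕ-reduce : ∀ z → + toℕ (reduce q z) ≈ z [mod q ]
  toℕ-reduce z = subst (λ r → + r ≈ z [mod q ]) (sym (Fin.toℕ-fromℕ< (n%ℕd<d z q)))
    (∣⇒≈ (ℤ.divides (- (z ℤ./ℕ q)) (difference (+ (z ℤ.%ℕ q)) (z ℤ./ℕ q) (+ q) (a≡a%ℕn+[a/ℕn]*n z q))))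
    where
    identity : ∀ r k m → r ℤ.- (r ℤ.+ k ℤ.* m) ≡ - k ℤ.* m
    identity = solve-∀
    difference : ∀ {z} r k m → z ≡ r ℤ.+ k ℤ.* m → r ℤ.- z ≡ - k ℤ.* m
    difference r k m refl = identity r k m

  ≡reduce⇒≈ : ∀ {i} z → i ≡ reduce q z → + toℕ i ≈ z [mod q ]
  ≡reduce⇒≈ z refl = toℕ-reduce z

  ≈⇒≡reduce : ∀ {i} z → + toℕ i ≈ z [mod q ] → i ≡ reduce q z
  ≈⇒≡reduce z i≈z = residue-unique (≈-trans i≈z (≈-sym (toℕ-reduce z)))

  -- The sum of residues is reduced after every addition; each reduction changes the representative
  -- by a multiple of `q` only.
  toℕ-sum : ∀ {n} (f : Vector (Fin q) n) → + toℕ (ℤ/q.sum f) ≈ sum ⟦ f ⟧ [mod q ]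
  toℕ-sum {ℕ.zero}  f = toℕ-reduce 0ℤ
  toℕ-sum {ℕ.suc n} f = ≈-trans (toℕ-reduce (⟦ f ⟧ zero ℤ.+ + toℕ (ℤ/q.sum (f ∘ suc))))
                                (≈-+-cong (≈-refl {x = ⟦ f ⟧ zero}) (toℕ-sum (f ∘ suc)))

  toℕ-· : ∀ {n} (u v : Vector (Fin q) n) → + toℕ (u ℤ/q.· v) ≈ ⟦ u ⟧ · ⟦ v ⟧ [mod q ]
  toℕ-· u v = ≈-trans (toℕ-sum λ j → reduce q (⟦ u ⟧ j ℤ.* ⟦ v ⟧ j))
                      (≈-sum-cong λ j → toℕ-reduce (⟦ u ⟧ j ℤ.* ⟦ v ⟧ j))

  toℕ-reduceᵥ-· : ∀ {n} (w : Vector ℤ n) x → + toℕ (reduceᵥ q w ℤ/q.· x) ≈ w · ⟦ x ⟧ [mod q ]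
  toℕ-reduceᵥ-· w x =
    ≈-trans (toℕ-· (reduceᵥ q w) x) (≈-·-congʳ ⟦ x ⟧ (toℕ-reduce ∘ w))

  ·≡reduce⇒≈ : ∀ {n} (w : Vector ℤ n) x c → reduceᵥ q w ℤ/q.· x ≡ reduce q c →
               w · ⟦ x ⟧ ≈ c [mod q ]
  ·≡reduce⇒≈ w x c eq = ≈-trans (≈-sym (toℕ-reduceᵥ-· w x)) (≡reduce⇒≈ c eq)

  ≈⇒·≡reduce : ∀ {n} (w : Vector ℤ n) x c → w · ⟦ x ⟧ ≈ c [mod q ] →
               reduceᵥ q w ℤ/q.· x ≡ reduce q c
  ≈⇒·≡reduce w x c wx≈c = ≈⇒≡reduce c (≈-trans (toℕ-reduceᵥ-· w x) wx≈c)

  -- The coefficients of a combination of columns are the entries of a solution. `Span` writes the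
  -- coefficients on the left, hence the commutation of the dot product.
  Col⇒solvable : ∀ {l n} (B : Matrix ℤ l n) b → Col q B (reduceᵥ q b) →
                 ∃ λ x → ∀ i → (B ∙ᵥ x) i ≈ b i [mod q ]
  Col⇒solvable B b (c , b≡cB) = ⟦ c ⟧ , λ i →
    ≈-trans (≈-reflexive (·-comm (B i) ⟦ c ⟧))
      (≈-trans (≈-·-congˡ ⟦ c ⟧ λ j → ≈-sym (toℕ-reduce (B i j)))
        (≈-trans (≈-sym (toℕ-· c (reduceᵥ q (B i)))) (≡reduce⇒≈ (b i) (sym (b≡cB i)))))

-- Surjectivity of the reduction from `V` modulo `N` to `V` modulo `q` (for `q` dividing `N`),
-- phrased on integer representatives. It is the common interface of the cases with and without
-- equations.
Liftable : ∀ {l n} → ℕ → ℕ → Matrix ℤ l n → Vector ℤ l → Set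
Liftable q N B b =
  ∀ x → (∀ i → (B ∙ᵥ x) i ≈ b i [mod q ]) →
  ∃ λ x′ → (∀ j → x′ j ≈ x j [mod q ]) × (∀ i → (B ∙ᵥ x′) i ≈ b i [mod N ])

-- Lifting solutions and points of the complement.

module _ {l n r} {B : Matrix ℤ l n} {d : Vector ℕ r} (inv : InvariantFactors B d)
         (b : Vector ℤ l) (p q : ℕ) .{{_ : NonZero (p * q)}} where

  -- A solution `x₀` modulo `p * q` is also one modulo `q`, so `x - x₀` lies in the kernel modulo
  -- `q`. `kernel-lift` corrects this difference, and adding `x₀` back restores the right-hand side.
  solutions-liftable : (∀ i → gcd p (d i) * gcd q (d i) ∣ d i) →
                       Col (p * q) B (reduceᵥ (p * q) b) → Liftable q (p * q) B b
  solutions-liftable gcds∣d b∈Col x Bx≈b = x′ , x′≈x , Bx′≈b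
    where
    solution = Col⇒solvable (p * q) B b b∈Col
    x₀ = proj₁ solution
    Bx₀≈b = proj₂ solution

    z : Vector ℤ n
    z j = x j ℤ.- x₀ j

    q∣Bz : ∀ i → + q ℤ.∣ (B ∙ᵥ z) i
    q∣Bz i = subst (+ q ℤ.∣_) (sym (·-distribˡ-- (B i) x x₀))
      (≈⇒∣ (≈-trans (Bx≈b i) (≈-sym (≈-weaken (ℕ.n∣m*n p) (Bx₀≈b i)))))

    lifted = kernel-lift inv p q gcds∣d z q∣Bz
    e = proj₁ lifted

    x′ : Vector ℤ n
    x′ j = (z j ℤ.+ e j) ℤ.+ x₀ j

    x′≈x : ∀ j → x′ j ≈ x j [mod q ]
    x′≈x j = ∣⇒≈ (subst (+ q ℤ.∣_) (identity (x j) (x₀ j) (e j)) (proj₁ (proj₂ lifted) j))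
      where
      identity : ∀ x y e → e ≡ (x ℤ.- y ℤ.+ e ℤ.+ y) ℤ.- x
      identity = solve-∀

    B[z+e]≈0 : ∀ i → (B ∙ᵥ (λ j → z j ℤ.+ e j)) i ≈ 0ℤ [mod p * q ]
    B[z+e]≈0 i = ∣⇒≈ (subst (_ ℤ.∣_) (sym (ℤ.+-identityʳ _)) (proj₂ (proj₂ lifted) i))

    Bx′≈b : ∀ i → (B ∙ᵥ x′) i ≈ b i [mod p * q ]
    Bx′≈b i = ≈-trans (≈-reflexive (·-distribˡ-+ (B i) (λ j → z j ℤ.+ e j) x₀))
      (≈-trans (≈-+-cong (B[z+e]≈0 i) (Bx₀≈b i)) (≈-reflexive (ℤ.+-identityˡ (b i))))

module _ {l m n} (A : Matrix ℤ m n) (a : Vector ℤ m) (B : Matrix ℤ l n) (b : Vector ℤ l)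
         (q N : ℕ) .{{_ : NonZero q}} .{{_ : NonZero N}} (q∣N : q ∣ N)
         (liftable : Liftable q N B b) where

  -- Membership is claimed for every residue vector `y` congruent to `x′`, because the vector
  -- counted later is decoded from an index and agrees with the reduction of `x′` only pointwise.
  M-lift : ∀ x → M q A a B b x → ∃ λ x′ → (∀ j → x′ j ≈ ⟦ x ⟧ j [mod q ]) ×
             (∀ y → (∀ j → ⟦ y ⟧ j ≈ x′ j [mod N ]) → M N A a B b y)
  M-lift x (x∈V , x∉H) = x′ , x′≈x , λ y y≈x′ → y∈V y y≈x′ , y∉H y y≈x′
    where
    lifted = liftable ⟦ x ⟧ (λ i → ·≡reduce⇒≈ q (B i) x (b i) (x∈V i))

    x′ : Vector ℤ n
    x′ = proj₁ lifted

    x′≈x : ∀ j → x′ j ≈ ⟦ x ⟧ j [mod q ]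
    x′≈x = proj₁ (proj₂ lifted)

    y∈V : ∀ y → (∀ j → ⟦ y ⟧ j ≈ x′ j [mod N ]) → V N A a B b y
    y∈V y y≈x′ i = ≈⇒·≡reduce N (B i) y (b i)
      (≈-trans (≈-·-congˡ (B i) {⟦ y ⟧} {x′} y≈x′) (proj₂ (proj₂ lifted) i))

    y∉H : ∀ y → (∀ j → ⟦ y ⟧ j ≈ x′ j [mod N ]) → ¬ ⋃ (Fin m) (H N A a B b) y
    -- An equation of `H` satisfied by `y` modulo `N` persists modulo `q`, where `y` and `x` agree;
    -- it would place `x` on the same `H`.
    y∉H y y≈x′ (i , _ , αy≡a) = x∉H (i , x∈V , ≈⇒·≡reduce q (A i) x (a i)
      (≈-trans (≈-·-congˡ (A i) {⟦ x ⟧} {⟦ y ⟧} x≈y)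
               (≈-weaken q∣N (·≡reduce⇒≈ N (A i) y (a i) αy≡a))))
      where
      x≈y : ∀ j → ⟦ x ⟧ j ≈ ⟦ y ⟧ j [mod q ]
      x≈y j = ≈-sym (≈-trans (≈-weaken q∣N (y≈x′ j)) (x′≈x j))

  -- Reduction modulo `q`, transported to the indices of the listed vectors, is the map given to
  -- `count-≤`; `M-lift` provides the preimages.
  #M-mono : #M q A a B b ≤ #M N A a B b
  #M-mono = count-≤ (M? q A a B b) (M? N A a B b) (vectors q) (vectors N) project lift
    where
    vectors : ∀ k → Vec (Vector (Fin k) n) (k ^ n)
    vectors k = Vec.tabulate (finToFun {k} {n})

    project : Fin (N ^ n) → Fin (q ^ n)
    project j = funToFin {n} {q} λ k → reduce q (⟦ finToFun {N} {n} j ⟧ k)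

    lift : ∀ i → M q A a B b (Vec.lookup (vectors q) i) →
           ∃ λ j → M N A a B b (Vec.lookup (vectors N) j) × project j ≡ i
    lift i i∈M = j ,
      subst (M N A a B b) (sym (Vec.lookup∘tabulate (finToFun {N} {n}) j)) (proj₂ (proj₂ lifted) y y≈x′) ,
      trans (funToFin-cong λ k → sym (≈⇒≡reduce q (⟦ y ⟧ k)
              (≈-sym (≈-trans (≈-weaken q∣N (y≈x′ k)) (proj₁ (proj₂ lifted) k)))))
            (Fin.funToFin-finToFin {n} {q} i)
      where
      lifted = M-lift (finToFun {q} {n} i)
        (subst (M q A a B b) (Vec.lookup∘tabulate (finToFun {q} {n}) i) i∈M)

      x′ = proj₁ lifted

      j : Fin (N ^ n)
      j = funToFin {n} {N} (reduceᵥ N x′)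

      y : Vector (Fin N) n
      y = finToFun {N} {n} j

      y≈x′ : ∀ k → ⟦ y ⟧ k ≈ x′ k [mod N ]
      y≈x′ k = ≡reduce⇒≈ N (x′ k) (Fin.finToFun-funToFin (reduceᵥ N x′) k)

theorem3p12 : ∀ {l m n : ℕ} (A : Matrix ℤ m n) (a : Vector ℤ m) (B : Matrix ℤ l n) (b : Vector ℤ l) →
    (∀ {r : ℕ} (d : Vector ℕ r) → InvariantFactors B d →
    ∀ (p q : ℕ) .{{_ : NonZero p}} .{{_ : NonZero q}} →
    (∀ i → gcd p (d i) * gcd q (d i) ∣ d i) →
    Col (p * q) {{m*n≢0 p q}} B (reduceᵥ (p * q) {{m*n≢0 p q}} b) →
    #M q A a B b ≤ #M (p * q) {{m*n≢0 p q}} A a B b)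
    ×
    (l ≡ 0 →
    ∀ (p q : ℕ) .{{_ : NonZero p}} .{{_ : NonZero q}} →
    #M q A a B b ≤ #M (p * q) {{m*n≢0 p q}} A a B b)
theorem3p12 A a B b =
  (λ d inv p q gcds∣d b∈Col → #M-mono A a B b q (p * q) {{_}} {{m*n≢0 p q}} (ℕ.n∣m*n p)
    (solutions-liftable inv b p q {{m*n≢0 p q}} gcds∣d b∈Col)) ,
  -- Now `B` has no rows, so the congruences to be preserved are indexed by an empty type and every
  -- `x` is its own lift.
  λ { refl p q → #M-mono A a B b q (p * q) {{_}} {{m*n≢0 p q}} (ℕ.n∣m*n p)
    λ x _ → x , (λ _ → ≈-refl) , λ () }
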